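{- Let $G$ be a graph of order $n$ such that both $G$ and its complement $\overline{G}$ are connected. Then $md(G)+md(\overline{G})\leq n+1$ if $n\geq 5$, and $md(G)+md(\overline{G})\geq 2$ if $n\geq 8$. Furthermore, both bounds are sharp: for every $n\geq5$ there is a graph $G$ of order $n$ with $G$ and $\overline{G}$ connected and $md(G)+md(\overline{G})=n+1$, and for every $n\geq 8$ there is a graph $G$ of order $n$ with $G$ and $\overline{G}$ connected and $md(G)+md(\overline{G})=2$.
   Context: Graphs are finite and simple. An edge-coloring of a graph $G$ is an arbitrary map from $E(G)$ to a finite set of colors (adjacent edges may receive the same color). For two distinct vertices $u,v$ of an edge-colored graph $G$, a monochromatic $uv$-cut is a set $M$ of edges, all of the same color, such that $u$ and $v$ lie in different components of $G-M$. An edge-coloring of $G$ is an $MD$-coloring (monochromatic disconnection coloring) if every two distinct vertices of $G$ are separated by a monochromatic cut. For a connected graph $G$, the monochromatic disconnection number $md(G)$ is the maximum number of colors actually used on $E(G)$ over all $MD$-colorings of $G$. -}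

module Defs where

open import Data.Bool.Base using (Bool; true; false)
import Data.Bool.Properties as Bool
open import Data.Fin.Base using (Fin; zero; suc; combine; remQuot; finToFun; funToFin)
open import Data.Fin.Properties
  using (_≟_; any?; all?; injective⇒≤; combine-injective; remQuot-combine; finToFun-funToFin)
open import Data.Fin.Subset using (Subset; _∈_; _∉_)
open import Data.Fin.Subset.Properties using (_∈?_; anySubset?)
open import Data.List.Base using (List; _∷_; length; filter; allFin; lookup)
open import Data.List.Membership.Propositional.Properties
  using (∈-allFin; ∈-filter⁺; ∈-filter⁻; ∈-lookup)
open import Data.List.Properties using (filter-all; length-tabulate)
import Data.List.Relation.Unary.All as All
open import Data.List.Relation.Unary.AllPairs using (_∷_)
import Data.List.Relation.Unary.Any as Any
open import Data.List.Relation.Unary.Any.Properties using (lookup-index)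
open import Data.List.Relation.Unary.Unique.Propositional using (Unique)
import Data.List.Relation.Unary.Unique.Propositional.Properties as Unique
open import Data.Nat.Base using (ℕ; zero; suc; _*_; _^_; _≤_; z≤n; s≤s⁻¹)
import Data.Nat.Properties as ℕ
open import Data.Product.Base using (Σ; ∃; ∃₂; Σ-syntax; _×_; _,_; proj₁; proj₂)
open import Data.Vec.Base using (tabulate)
open import Data.Vec.Properties using (lookup∘tabulate; []=⇒lookup; lookup⇒[]=)
open import Function.Base using (_∘_)
open import Level using (0ℓ)
open import Relation.Binary.Construct.Closure.ReflexiveTransitive using (Star; ε; _◅_; _◅◅_)
import Relation.Binary.Construct.Closure.ReflexiveTransitive as Star
open import Relation.Binary.Core using (Rel)
open import Relation.Binary.Definitions using (Decidable; Symmetric)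
open import Relation.Binary.PropositionalEquality
  using (_≡_; _≢_; refl; sym; trans; cong; subst; ≢-sym)
open import Relation.Nullary.Decidable
  using (Dec; does; yes; no; map′; ¬?; _×-dec_; _→-dec_; dec-true; decidable-stable)
open import Relation.Nullary.Negation using (¬_; contradiction)
open import Relation.Unary using (Pred)
import Relation.Unary as U

record Graph (n : ℕ) : Set₁ where
  field
    Adj    : Rel (Fin n) 0ℓ
    adj?   : Decidable Adj
    symm   : Symmetric Adj
    irrefl : ∀ {u} → ¬ Adj u u

open Graph public

complement : ∀ {n} → Graph n → Graph n
complement G .Adj u v = u ≢ v × ¬ Adj G u v
complement G .adj? u v = ¬? (u ≟ v) ×-dec ¬? (adj? G u v)
complement G .symm (u≢v , ¬uv) = ≢-sym u≢v , ¬uv ∘ symm G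
complement G .irrefl (u≢u , _) = u≢u refl

-- The vertices u and v lie in the same component of G.
Joined : ∀ {n} (G : Graph n) → Rel (Fin n) 0ℓ
Joined G = Star (Adj G)

Connected : ∀ {n} → Graph n → Set
Connected G = ∀ u v → Joined G u v

-- A map E(G) → A.  An edge occurs here as an adjacency proof, in either of
-- its two orientations; `unordered` makes the value depend on the edge {u,v}
-- only (see `at-irrelevant` for the independence of the chosen proof).
record EdgeMap {n} (G : Graph n) (A : Set) : Set where
  field
    at        : ∀ {u v} → Adj G u v → A
    unordered : ∀ {u v} (e : Adj G u v) (e′ : Adj G v u) → at e ≡ at e′

  at-irrelevant : ∀ {u v} (e e′ : Adj G u v) → at e ≡ at e′
  at-irrelevant e e′ = trans (unordered e (symm G e)) (unordered (symm G e) e′)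

open EdgeMap public

Coloring : ∀ {n} → Graph n → ℕ → Set
Coloring G k = EdgeMap G (Fin k)

-- A set of edges, given by its characteristic function.
EdgeSet : ∀ {n} → Graph n → Set
EdgeSet G = EdgeMap G Bool

someEdge? : ∀ {n} {G : Graph n} {A : Set} {P : Pred A 0ℓ} → U.Decidable P → (f : EdgeMap G A) →
            Dec (∃₂ λ u v → Σ[ e ∈ Adj G u v ] P (at f e))
someEdge? {G = G} {P = P} P? f = any? λ u → any? λ v → edge? u v
  where
  edge? : ∀ u v → Dec (Σ[ e ∈ Adj G u v ] P (at f e))
  edge? u v with adj? G u v
  ... | no ¬e = no (¬e ∘ proj₁)
  ... | yes e = map′ (e ,_) (λ (e′ , p) → subst P (at-irrelevant f e′ e) p) (P? (at f e))

removeEdges : ∀ {n} (G : Graph n) → EdgeSet G → Graph n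
removeEdges G M .Adj u v = Σ[ e ∈ Adj G u v ] at M e ≡ false
removeEdges G M .adj? u v with adj? G u v
... | no ¬e = no (¬e ∘ proj₁)
... | yes e = map′ (e ,_) (λ (e′ , p) → trans (at-irrelevant M e e′) p) (at M e Bool.≟ false)
removeEdges G M .symm (e , p) = symm G e , trans (unordered M (symm G e) e) p
removeEdges G M .irrefl (e , _) = irrefl G e

Monochromatic : ∀ {n k} {G : Graph n} → Coloring G k → EdgeSet G → Set
Monochromatic {G = G} c M =
  ∀ {u v x y} (e : Adj G u v) (f : Adj G x y) → at M e ≡ true → at M f ≡ true → at c e ≡ at c f

MonochromaticCut : ∀ {n k} {G : Graph n} → Coloring G k → Fin n → Fin n → EdgeSet G → Set
MonochromaticCut {G = G} c u v M = Monochromatic c M × ¬ Joined (removeEdges G M) u v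

IsMDColoring : ∀ {n k} {G : Graph n} → Coloring G k → Set
IsMDColoring {G = G} c = ∀ u v → u ≢ v → Σ[ M ∈ EdgeSet G ] MonochromaticCut c u v M

Used : ∀ {n k} {G : Graph n} → Coloring G k → Fin k → Set
Used {G = G} c i = ∃₂ λ u v → Σ[ e ∈ Adj G u v ] at c e ≡ i

used? : ∀ {n k} {G : Graph n} (c : Coloring G k) → U.Decidable (Used c)
used? c i = someEdge? (_≟ i) c

#colorsUsed : ∀ {n k} {G : Graph n} → Coloring G k → ℕ
#colorsUsed {k = k} c = length (filter (used? c) (allFin k))

-- m is the maximum number of colors used by an MD-coloring of G.
record IsMDNumber {n} (G : Graph n) (m : ℕ) : Set where
  field
    attained : ∃ λ k → Σ[ c ∈ Coloring G k ] IsMDColoring c × #colorsUsed c ≡ m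
    maximal  : ∀ {k} (c : Coloring G k) → IsMDColoring c → #colorsUsed c ≤ m

-- The rest shows that this maximum exists, constructively: being an
-- MD-coloring is decidable, colorings may be taken onto their color set, and
-- such a color set has at most n * n elements.

-- u and v are separated iff some union S of components contains u but not v.
separated? : ∀ {n} (G : Graph n) u v → Dec (¬ Joined G u v)
separated? {n} G u v = map′ sound complete (anySubset? closed?)
  where
  Closed : Subset n → Set
  Closed S = u ∈ S × v ∉ S × (∀ x y → Adj G x y → x ∈ S → y ∈ S)

  closed? : U.Decidable Closed
  closed? S = u ∈? S ×-dec ¬? (v ∈? S) ×-dec
    all? λ x → all? λ y → adj? G x y →-dec (x ∈? S →-dec y ∈? S)

  sound : ∃ Closed → ¬ Joined G u v
  sound (S , u∈S , v∉S , cl) p = v∉S (go p u∈S)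
    where
    go : ∀ {x y} → Joined G x y → x ∈ S → y ∈ S
    go ε        x∈S = x∈S
    go (e ◅ es) x∈S = go es (cl _ _ e x∈S)

  ¬¬-decidable : ∀ {m} (P : Pred (Fin m) 0ℓ) → ¬ ¬ (∀ i → Dec (P i))
  ¬¬-decidable {zero}  P k = k λ ()
  ¬¬-decidable {suc m} P k = ¬¬-decidable (P ∘ suc) λ d →
    let k′ = λ d₀ → k λ { zero → d₀ ; (suc i) → d i }
    in k′ (no (k′ ∘ yes))

  module _ (reach? : ∀ w → Dec (Joined G u w)) where
    S : Subset n
    S = tabulate (does ∘ reach?)

    ∈⁺ : ∀ {w} → Joined G u w → w ∈ S
    ∈⁺ {w} p = lookup⇒[]= w S
      (trans (lookup∘tabulate (does ∘ reach?) w) (dec-true (reach? w) p))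

    ∈⁻ : ∀ {w} → w ∈ S → Joined G u w
    ∈⁻ {w} w∈S with reach? w | lookup∘tabulate (does ∘ reach?) w
    ... | yes p | _  = p
    ... | no  _ | eq = contradiction (trans (sym eq) ([]=⇒lookup w∈S)) λ ()

  complete : ¬ Joined G u v → ∃ Closed
  complete ¬p = decidable-stable (anySubset? closed?) λ ¬∃ →
    ¬¬-decidable (Joined G u) λ r? → ¬∃ (S r? , ∈⁺ r? ε , ¬p ∘ ∈⁻ r? ,
      λ x y e x∈S → ∈⁺ r? (∈⁻ r? x∈S ◅◅ (e ◅ ε)))

colorClass : ∀ {n k} {G : Graph n} → Coloring G k → Fin k → EdgeSet G
colorClass c i .at e = does (at c e ≟ i)
colorClass c i .unordered e e′ = cong (λ j → does (j ≟ i)) (unordered c e e′)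

∈-colorClass⁺ : ∀ {k} {i j : Fin k} → i ≡ j → does (i ≟ j) ≡ true
∈-colorClass⁺ {i = i} {j} = dec-true (i ≟ j)

∈-colorClass⁻ : ∀ {k} {i j : Fin k} → does (i ≟ j) ≡ true → i ≡ j
∈-colorClass⁻ {i = i} {j} eq with i ≟ j
... | yes i≡j = i≡j
... | no  _   = contradiction eq λ ()

mdColoring? : ∀ {n k} {G : Graph n} (c : Coloring G (suc k)) → Dec (IsMDColoring c)
mdColoring? {n} {k} {G} c = all? λ u → all? λ v → ¬? (u ≟ v) →-dec cut? u v
  where
  G∖ : Fin (suc k) → Graph n
  G∖ i = removeEdges G (colorClass c i)

  -- It suffices to try the full color classes.
  cut? : ∀ u v → Dec (Σ[ M ∈ EdgeSet G ] MonochromaticCut c u v M)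
  cut? u v = map′
    (λ (i , ¬p) → colorClass c i , (λ e f p q → trans (∈-colorClass⁻ p) (sym (∈-colorClass⁻ q))) , ¬p)
    full
    (any? λ i → separated? (G∖ i) u v)
    where
    enlarge : ∀ (M : EdgeSet G) i → (∀ {x y} (e : Adj G x y) → at M e ≡ true → at c e ≡ i) →
              ∀ {x y} → Adj (G∖ i) x y → Adj (removeEdges G M) x y
    enlarge M i M⊆i (e , e∉i) = e , Bool.¬-not λ e∈M →
      contradiction (trans (sym (∈-colorClass⁺ (M⊆i e e∈M))) e∉i) λ ()

    full : Σ[ M ∈ EdgeSet G ] MonochromaticCut c u v M → ∃ λ i → ¬ Joined (G∖ i) u v
    full (M , mono , ¬p) with someEdge? (Bool._≟ true) M
    ... | yes (_ , _ , f , f∈M) =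
      at c f , ¬p ∘ Star.map (enlarge M (at c f) λ e e∈M → mono e f e∈M f∈M)
    ... | no M=∅ =
      zero , ¬p ∘ Star.map (enlarge M zero λ e e∈M → contradiction (_ , _ , e , e∈M) M=∅)

-- Any coloring that identifies at least the same pairs of edges is again MD.
mdColoring-resp : ∀ {n k l} {G : Graph n} (c : Coloring G k) (d : Coloring G l) →
  (∀ {u v x y} (e : Adj G u v) (f : Adj G x y) → at c e ≡ at c f → at d e ≡ at d f) →
  IsMDColoring c → IsMDColoring d
mdColoring-resp c d c⇒d md u v u≢v with md u v u≢v
... | M , mono , ¬p = M , (λ e f e∈M f∈M → c⇒d e f (mono e f e∈M f∈M)) , ¬p

OntoMD : ∀ {n k} {G : Graph n} → Coloring G k → Set
OntoMD c = IsMDColoring c × (∀ i → Used c i)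

ontoMD? : ∀ {n k} {G : Graph n} (c : Coloring G (suc k)) → Dec (OntoMD c)
ontoMD? c = mdColoring? c ×-dec all? (used? c)

ontoMD-resp : ∀ {n k} {G : Graph n} (c d : Coloring G k) →
  (∀ {u v} (e : Adj G u v) → at c e ≡ at d e) → OntoMD c → OntoMD d
ontoMD-resp c d c≗d (md , onto) =
  mdColoring-resp c d (λ e f eq → trans (sym (c≗d e)) (trans eq (c≗d f))) md ,
  λ i → let (u , v , e , eq) = onto i in u , v , e , trans (sym (c≗d e)) eq

#colorsUsed-onto : ∀ {n k} {G : Graph n} (c : Coloring G k) → (∀ i → Used c i) → #colorsUsed c ≡ k
#colorsUsed-onto {k = k} c onto =
  trans (cong length (filter-all (used? c) (All.universal onto (allFin k)))) (length-tabulate {n = k} (λ i → i))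

lookup-injective : ∀ {A : Set} {xs : List A} → Unique xs → ∀ i j → lookup xs i ≡ lookup xs j → i ≡ j
lookup-injective (x∉ ∷ u) zero    zero    eq = refl
lookup-injective (x∉ ∷ u) zero    (suc j) eq = contradiction eq (All.lookup x∉ (∈-lookup j))
lookup-injective (x∉ ∷ u) (suc i) zero    eq = contradiction (sym eq) (All.lookup x∉ (∈-lookup i))
lookup-injective (x∉ ∷ u) (suc i) (suc j) eq = cong suc (lookup-injective u i j eq)

-- Discarding the unused colors.
compress : ∀ {n k} {G : Graph n} (c : Coloring G k) → IsMDColoring c →
           Σ[ d ∈ Coloring G (#colorsUsed c) ] OntoMD d
compress {k = k} {G} c md = d , mdColoring-resp c d same md , onto
  where
  colors : List (Fin k)
  colors = filter (used? c) (allFin k)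

  position : ∀ {u v} → Adj G u v → Fin (length colors)
  position e = Any.index (∈-filter⁺ (used? c) (∈-allFin (at c e)) (_ , _ , e , refl))

  color : ∀ {u v} (e : Adj G u v) → at c e ≡ lookup colors (position e)
  color e = lookup-index (∈-filter⁺ (used? c) (∈-allFin (at c e)) (_ , _ , e , refl))

  at-position : ∀ {u v} (e : Adj G u v) j → at c e ≡ lookup colors j → position e ≡ j
  at-position e j eq = lookup-injective (Unique.filter⁺ (used? c) (Unique.allFin⁺ k)) _ _
    (trans (sym (color e)) eq)

  same : ∀ {u v x y} (e : Adj G u v) (f : Adj G x y) → at c e ≡ at c f → position e ≡ position f
  same e f eq = at-position e (position f) (trans eq (color f))

  d : Coloring G (#colorsUsed c)
  d .at = position
  d .unordered e e′ = same e e′ (unordered c e e′)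

  onto : ∀ i → Used d i
  onto i with ∈-filter⁻ (used? c) {xs = allFin k} (∈-lookup {xs = colors} i)
  ... | _ , u , v , e , eq = u , v , e , at-position e i eq

onto⇒≤ : ∀ {n k} {G : Graph n} (c : Coloring G k) → (∀ i → Used c i) → k ≤ n * n
onto⇒≤ {n} {k} {G} c onto = injective⇒≤ {f = code} injective
  where
  code : Fin k → Fin (n * n)
  code i = let (u , v , _) = onto i in combine u v

  color≡ : ∀ {i j} ((u , v , _) : Used c i) ((x , y , _) : Used c j) → u ≡ x × v ≡ y → i ≡ j
  color≡ (_ , _ , e , refl) (_ , _ , f , refl) (refl , refl) = at-irrelevant c e f

  injective : ∀ {i j} → code i ≡ code j → i ≡ j
  injective {i} {j} eq = color≡ (onto i) (onto j) (combine-injective _ _ _ _ eq)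

∃ontoMD? : ∀ {n} (G : Graph n) k → Dec (Σ[ c ∈ Coloring G (suc k) ] OntoMD c)
∃ontoMD? {n} G k = map′ (λ (i , s , r) → coloring i s , r) encode (any? good?)
  where
  Code : Set
  Code = Fin (suc k ^ (n * n))

  decode : Code → Fin n → Fin n → Fin (suc k)
  decode i u v = finToFun i (combine u v)

  Symm : Code → Set
  Symm i = ∀ u v → Adj G u v → decode i u v ≡ decode i v u

  coloring : ∀ i → Symm i → Coloring G (suc k)
  coloring i s .at {u} {v} _ = decode i u v
  coloring i s .unordered {u} {v} e _ = s u v e

  Good : Code → Set
  Good i = Σ[ s ∈ Symm i ] OntoMD (coloring i s)

  good? : U.Decidable Good
  good? i with all? (λ u → all? λ v → adj? G u v →-dec (decode i u v ≟ decode i v u))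
  ... | no ¬s = no (¬s ∘ proj₁)
  ... | yes s = map′ (s ,_)
    (λ (s′ , r) → ontoMD-resp (coloring i s′) (coloring i s) (λ _ → refl) r)
    (ontoMD? (coloring i s))

  encode : Σ[ c ∈ Coloring G (suc k) ] OntoMD c → ∃ Good
  encode (c , r) = i , s , ontoMD-resp c (coloring i s) (sym ∘ decode-encode) r
    where
    value : Fin n × Fin n → Fin (suc k)
    value (u , v) with adj? G u v
    ... | yes e = at c e
    ... | no  _ = zero

    value-edge : ∀ {u v} (e : Adj G u v) → value (u , v) ≡ at c e
    value-edge {u} {v} e with adj? G u v
    ... | yes e′ = at-irrelevant c e′ e
    ... | no  ¬e = contradiction e ¬e

    i : Code
    i = funToFin (value ∘ remQuot n)

    decode-encode : ∀ {u v} (e : Adj G u v) → decode i u v ≡ at c e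
    decode-encode {u} {v} e = trans (finToFun-funToFin (value ∘ remQuot n) (combine u v))
      (trans (cong value (remQuot-combine u v)) (value-edge e))

    s : Symm i
    s u v e = trans (decode-encode e)
      (trans (unordered c e (symm G e)) (sym (decode-encode (symm G e))))

greatest : {P : Pred ℕ 0ℓ} → U.Decidable P → ∃ P → ∀ b → (∀ {m} → P m → m ≤ b) →
           ∃ λ m → P m × (∀ {l} → P l → l ≤ m)
greatest {P} P? (m , pm) zero    bound = m , pm , λ pl → ℕ.≤-trans (bound pl) z≤n
greatest {P} P? ∃P       (suc b) bound with P? (suc b)
... | yes p = suc b , p , bound
... | no ¬p = greatest P? ∃P b λ {m} pm →
  s≤s⁻¹ (ℕ.≤∧≢⇒< (bound pm) λ { refl → ¬p pm })

mdNumber-exists : ∀ {n} (G : Graph n) → ∃ (IsMDNumber G)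
mdNumber-exists {n} G with any? (λ u → any? λ v → adj? G u v)
... | no ¬e = 0 , record
  { attained = 0 , c₀ , md₀ , refl
  ; maximal  = λ c md → none (compress c md) }
  where
  none : ∀ {m} → Σ[ d ∈ Coloring G m ] OntoMD d → m ≤ 0
  none {zero}  _ = z≤n
  none {suc m} (d , _ , onto) with onto zero
  ... | u , v , e , _ = contradiction (u , v , e) ¬e

  c₀ : Coloring G 0
  c₀ .at e = contradiction (_ , _ , e) ¬e
  c₀ .unordered e _ = contradiction (_ , _ , e) ¬e

  md₀ : IsMDColoring c₀
  md₀ u v u≢v = M , (λ e _ _ _ → contradiction (_ , _ , e) ¬e) ,
    λ { ε → u≢v refl ; ((e , _) ◅ _) → ¬e (_ , _ , e) }
    where
    M : EdgeSet G
    M .at _ = false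
    M .unordered _ _ = refl
... | yes (a , b , ab) = let (m , (c , md , onto) , max) = greatest P? (1 , c₁ , md₁ , onto₁) (n * n) bound in
  m , record
  { attained = m , c , md , #colorsUsed-onto c onto
  ; maximal  = λ c′ md′ → max (compress c′ md′) }
  where
  P : Pred ℕ 0ℓ
  P m = Σ[ c ∈ Coloring G m ] OntoMD c

  P? : U.Decidable P
  P? zero    = no λ (c , _) → case₀ (at c ab)
    where
    case₀ : ¬ Fin 0
    case₀ ()
  P? (suc k) = ∃ontoMD? G k

  bound : ∀ {m} → P m → m ≤ n * n
  bound (c , _ , onto) = onto⇒≤ c onto

  c₁ : Coloring G 1
  c₁ .at _ = zero
  c₁ .unordered _ _ = refl

  md₁ : IsMDColoring c₁
  md₁ u v u≢v = M , (λ _ _ _ _ → refl) , λ { ε → u≢v refl ; ((_ , ()) ◅ _) }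
    where
    M : EdgeSet G
    M .at _ = true
    M .unordered _ _ = refl

  onto₁ : ∀ i → Used c₁ i
  onto₁ zero = a , b , ab , refl

-- The monochromatic disconnection number.  It is defined here for every
-- graph, the intended use being for connected ones.  It is kept abstract
-- since evaluating the search is infeasible; `md-isMDNumber` characterizes it.
abstract
  md : ∀ {n} → Graph n → ℕ
  md G = proj₁ (mdNumber-exists G)

  md-isMDNumber : ∀ {n} (G : Graph n) → IsMDNumber G (md G)
  md-isMDNumber G = proj₂ (mdNumber-exists G)

{-# OPTIONS --safe #-}
-- For an MD-coloring, the color of an edge uv occurs on every uv-path.  Hence,
-- if a connected vertex set uses the colors C, then a new vertex with one
-- neighbor in the set adds at most one color, and a vertex with two neighbors
-- a, b adds none: the color separating a from b lies in C, and it is the color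
-- of av or of bv.  So md G is at most the number of vertices that have exactly
-- one earlier neighbor in a connected ordering of G.
--
-- For the upper bound, start the orderings of G and of its complement with
-- small connected sets that share three vertices x, y, z.  Any further vertex
-- has two neighbors among x, y, z in one of the two graphs, so it adds at most
-- one color in total.  A paw or a claw (in either graph) or a 5-cycle provides
-- a start with few enough colors, and one of them always exists.
module Submission where

open import Defs
open import Data.Bool.Base using (Bool; true; false; T)
open import Data.Bool.Properties using (T?)
open import Data.Empty using (⊥)
open import Data.Fin.Base using (Fin; zero; suc; toℕ)
open import Data.Fin.Patterns
import Data.Fin.Base as Fin
import Data.Fin.Properties as Fin
open import Data.List.Base using (List; []; _∷_; _++_; [_]; length; lookup; allFin; tabulate)
open import Data.List.Membership.Propositional using (_∈_; _∉_)
open import Data.List.Membership.Propositional.Properties using (∈-allFin; ∈-tabulate⁺; ∈-++⁺ˡ; ∈-++⁺ʳ)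
open import Data.List.Properties using (length-tabulate)
open import Data.List.Relation.Unary.All as All using (All; []; _∷_)
import Data.List.Relation.Unary.All.Properties as All using (tabulate⁺)
open import Data.List.Relation.Unary.AllPairs using ([]; _∷_)
open import Data.List.Relation.Unary.Any using (here; there; index)
open import Data.List.Relation.Unary.Any.Properties using (lookup-index)
open import Data.List.Relation.Unary.Unique.Propositional using (Unique)
open import Data.Nat.Base
open import Data.Nat.Properties
open import Data.Product.Base using (∃; ∃₂; Σ-syntax; ∃-syntax; _×_; _,_; proj₁; proj₂)
open import Data.Sum.Base using (_⊎_; inj₁; inj₂; [_,_]′; swap)
import Data.Sum.Base as Sum
open import Function.Base using (_∘_; id)
open import Level using (0ℓ)
open import Relation.Binary.Core using (Rel)
open import Relation.Binary.Definitions using (Decidable; tri<; tri≈; tri>)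
open import Relation.Binary.Construct.Closure.ReflexiveTransitive using (Star; ε; _◅_; _◅◅_; reverse)
import Relation.Binary.Construct.Closure.ReflexiveTransitive as Star
open import Relation.Binary.PropositionalEquality
  using (_≡_; _≢_; refl; sym; trans; cong; subst; subst₂; cong₂; ≢-sym)
open import Relation.Nullary.Decidable using (yes; no; ¬?; decidable-stable; True; toWitness; _⊎-dec_)
open import Relation.Nullary.Negation using (¬_; contradiction)
open import Relation.Unary using (Pred)

private variable
  n k m m′ : ℕ

module _ {n : ℕ} where
  open import Data.List.Membership.DecPropositional (Fin._≟_ {n}) public using (_∈?_)

-- Connected orderings and the colors of an MD-coloring

adj⇒≢ : (G : Graph n) → ∀ {u v} → Adj G u v → u ≢ v
adj⇒≢ G e refl = irrefl G e

cover⇒≤ : (xs : List (Fin k)) → (∀ i → i ∈ xs) → k ≤ length xs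
cover⇒≤ xs mem = Fin.injective⇒≤ {f = index ∘ mem} λ {i} {j} eq →
  trans (lookup-index (mem i)) (trans (cong (lookup xs) eq) (sym (lookup-index (mem j))))

-- A connected ordering, latest vertex first. The index counts the vertices attached along a single
-- edge, hence the colors the ordering may cost.
data Built (G : Graph n) : List (Fin n) → ℕ → Set where
  base    : ∀ v → Built G [ v ] 0
  attach  : ∀ {L a v} → Built G L m → a ∈ L → Adj G a v → Built G (v ∷ L) (suc m)
  attach² : ∀ {L a b v} → Built G L m → a ∈ L → b ∈ L → a ≢ b → Adj G a v → Adj G b v →
            Built G (v ∷ L) m

module _ {G : Graph n} (c : Coloring G k) where

  Linked : List (Fin k) → Rel (Fin n) 0ℓ
  Linked C = Star λ u v → Σ[ e ∈ Adj G u v ] at c e ∈ C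

  linked-sym : ∀ {C u v} → Linked C u v → Linked C v u
  linked-sym = reverse λ (e , p) → symm G e , subst (_∈ _) (unordered c e (symm G e)) p

  -- Follow the path up to its first edge in `M`.
  joined-or-cut : ∀ {C} (M : EdgeSet G) {u v} → Linked C u v →
    Joined (removeEdges G M) u v ⊎ (∃₂ λ x y → Σ[ e ∈ Adj G x y ] at M e ≡ true × at c e ∈ C)
  joined-or-cut M ε = inj₁ ε
  joined-or-cut M ((e , i∈C) ◅ p) with at M e in eq
  ... | true  = inj₂ (_ , _ , e , eq , i∈C)
  ... | false = Sum.map₁ ((e , eq) ◅_) (joined-or-cut M p)

  module _ (md : IsMDColoring c) where

    -- The path meets the cut that the MD-coloring provides, so the one color of that cut lies in
    -- `C`.
    linked-cut : ∀ {C u v} → u ≢ v → Linked C u v → Σ[ M ∈ EdgeSet G ]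
      (∀ {x y} (e : Adj G x y) → at M e ≡ true → at c e ∈ C) × ¬ Joined (removeEdges G M) u v
    linked-cut u≢v p with md _ _ u≢v
    ... | M , mono , ¬joined with joined-or-cut M p
    ...   | inj₁ joined = contradiction joined ¬joined
    ...   | inj₂ (_ , _ , f , f∈M , i∈C) = M , (λ e e∈M → subst (_∈ _) (mono f e f∈M e∈M) i∈C) , ¬joined

    -- The edge itself is a path, so every cut between its ends contains it.
    linked-edge : ∀ {C u v} → Linked C u v → (e : Adj G u v) → at c e ∈ C
    linked-edge p e with linked-cut (adj⇒≢ G e) p
    ... | M , M⊆C , ¬joined with at M e in eq
    ...   | true  = M⊆C e eq
    ...   | false = contradiction ((e , eq) ◅ ε) ¬joined

    -- A cut between `a` and `b` must meet the path through `v`.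
    linked-cherry : ∀ {C a b v} → a ≢ b → Linked C a b → (e : Adj G a v) (f : Adj G b v) →
      at c e ∈ C ⊎ at c f ∈ C
    linked-cherry a≢b p e f with linked-cut a≢b p
    ... | M , M⊆C , ¬joined with at M e in eq | at M f in eq′
    ...   | true  | _     = inj₁ (M⊆C e eq)
    ...   | false | true  = inj₂ (M⊆C f eq′)
    ...   | false | false =
      contradiction ((e , eq) ◅ symm (removeEdges G M) (f , eq′) ◅ ε) ¬joined

    AllLinked : List (Fin n) → List (Fin k) → Set
    AllLinked L C = ∀ {u v} → u ∈ L → v ∈ L → Linked C u v

    allLinked-∷ : ∀ {L C a v} → AllLinked L C → a ∈ L → Linked C a v → AllLinked (v ∷ L) C
    allLinked-∷ all a∈L p (here refl) (here refl) = ε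
    allLinked-∷ all a∈L p (here refl) (there y)   = linked-sym p ◅◅ all a∈L y
    allLinked-∷ all a∈L p (there x)   (here refl) = all x a∈L ◅◅ p
    allLinked-∷ all a∈L p (there x)   (there y)   = all x y

    -- A single edge puts its own color into `C`. Of two edges to `v`, one has a color in `C`
    -- already, and `v` is linked through that one.
    built⇒linked : ∀ {L} → Built G L m → Σ[ C ∈ List (Fin k) ] length C ≡ m × AllLinked L C
    built⇒linked (base v) = [] , refl , λ { (here refl) (here refl) → ε }
    built⇒linked (attach b a∈L e) with built⇒linked b
    ... | C , len , all = at c e ∷ C , cong suc len ,
      allLinked-∷ (λ x y → Star.map (λ (f , i) → f , there i) (all x y)) a∈L ((e , here refl) ◅ ε)
    built⇒linked (attach² b a∈L b∈L a≢b e f) with built⇒linked b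
    ... | C , len , all with linked-cherry a≢b (all a∈L b∈L) e f
    ...   | inj₁ i = C , len , allLinked-∷ all a∈L ((e , i) ◅ ε)
    ...   | inj₂ i = C , len , allLinked-∷ all b∈L ((f , i) ◅ ε)

-- Take an optimal coloring onto its used colors: once all vertices are linked by `C`, `linked-edge`
-- puts every color into `C`.
built⇒md≤ : ∀ {G : Graph n} {L} → Built G L m → (∀ v → v ∈ L) → md G ≤ m
built⇒md≤ {m = m} {G} b cover with IsMDNumber.attained (md-isMDNumber G)
... | k , c , mdc , eq with compress c mdc
...   | d , mdd , onto with built⇒linked d mdd b
...     | C , len , all = subst₂ _≤_ eq len (cover⇒≤ C λ i →
  let (u , v , e , ei) = onto i in subst (_∈ C) ei (linked-edge d mdd (all (cover u) (cover v)) e))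

onto⇒≤md : ∀ {G : Graph n} (c : Coloring G k) → OntoMD c → k ≤ md G
onto⇒≤md {G = G} c (mdc , onto) =
  subst (_≤ md G) (#colorsUsed-onto c onto) (IsMDNumber.maximal (md-isMDNumber G) c mdc)

-- The lower bound

monochrome : (G : Graph n) → Coloring G 1
monochrome G .at _ = zero
monochrome G .unordered _ _ = refl

monochrome-md : (G : Graph n) → IsMDColoring (monochrome G)
monochrome-md G u v u≢v = everything , (λ _ _ _ _ → refl) , λ { ε → u≢v refl ; ((_ , ()) ◅ _) }
  where
  everything : EdgeSet G
  everything .at _ = true
  everything .unordered _ _ = refl

edge⇒1≤md : (G : Graph n) → ∀ {u v} → Adj G u v → 1 ≤ md G
edge⇒1≤md G e = onto⇒≤md (monochrome G) (monochrome-md G , λ { zero → _ , _ , e , refl })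

firstEdge : (G : Graph n) → ∀ {u v} → u ≢ v → Joined G u v → ∃ (Adj G u)
firstEdge G u≢v ε       = contradiction refl u≢v
firstEdge G u≢v (e ◅ _) = _ , e

connected⇒1≤md : (G : Graph (suc (suc n))) → Connected G → 1 ≤ md G
connected⇒1≤md G conn = edge⇒1≤md G (proj₂ (firstEdge G (λ ()) (conn zero (suc zero))))

-- Links are walks, and the one-color coloring is an MD-coloring of any graph.
built⇒connected : ∀ {G : Graph n} {L} → Built G L m → (∀ v → v ∈ L) → Connected G
built⇒connected {G = G} b cover u v =
  Star.map proj₁ (proj₂ (proj₂ (built⇒linked (monochrome G) (monochrome-md G) b)) (cover u) (cover v))

-- Extending a partial ordering

∃∈ : ∀ {G : Graph n} {L} → Built G L m → ∃ (_∈ L)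
∃∈ (base v)              = v , here refl
∃∈ (attach _ _ _)        = _ , here refl
∃∈ (attach² _ _ _ _ _ _) = _ , here refl

crossing : (G : Graph n) (L : List (Fin n)) → ∀ {u v} → u ∈ L → v ∉ L → Joined G u v →
           ∃₂ λ x y → x ∈ L × y ∉ L × Adj G x y
crossing G L u∈L v∉L ε = contradiction u∈L v∉L
crossing G L u∈L v∉L (_◅_ {j = w} e p) with w ∈? L
... | yes w∈L = crossing G L w∈L v∉L p
... | no  w∉L = _ , _ , u∈L , w∉L , e

extract : ∀ {x : Fin n} {xs} → x ∈ xs →
  Σ[ ys ∈ List (Fin n) ] length xs ≡ suc (length ys) × (∀ {v} → v ∈ xs → v ≢ x → v ∈ ys)
extract {xs = _ ∷ xs} (here refl) = xs , refl , λ where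
  (here refl) v≢x → contradiction refl v≢x
  (there v∈)  _   → v∈
extract {xs = y ∷ xs} (there x∈) with extract x∈
... | ys , len , rest = y ∷ ys , cong suc len , λ where
  (here refl) _   → here refl
  (there v∈)  v≢x → there (rest v∈ v≢x)

-- Distinctness of `xs` makes the count of the remaining entries exact, which the bound `n + 1`
-- requires.
extractAll : ∀ {xs ys : List (Fin n)} → Unique xs → (∀ {v} → v ∈ xs → v ∈ ys) →
  Σ[ zs ∈ List (Fin n) ] length ys ≡ length xs + length zs × (∀ {v} → v ∈ ys → v ∈ xs ⊎ v ∈ zs)
extractAll {ys = ys} [] _ = ys , refl , inj₂
extractAll {xs = x ∷ xs} (x∉ ∷ u) sub with extract (sub (here refl))
... | ys′ , len , rest with extractAll u (λ v∈ → rest (sub (there v∈)) (λ { refl → All.lookup x∉ v∈ refl }))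
...   | zs , len′ , split = zs , trans len (cong suc len′) , λ {v} → cases v
  where
  cases : ∀ v → v ∈ _ → v ∈ x ∷ xs ⊎ v ∈ zs
  cases v v∈ with v Fin.≟ x
  ... | yes refl = inj₁ (here refl)
  ... | no  v≢x  = Sum.map₁ there (split (rest v∈ v≢x))

-- Connectivity always offers an edge leaving `L`, so each vertex of `R` costs at most one color.
extend : ∀ {G : Graph n} {L} → Connected G → Built G L m → ∀ R → (∀ v → v ∈ L ⊎ v ∈ R) →
         md G ≤ m + length R
extend {n} {G = G} conn b R cover = go b R (length R) refl cover
  where
  -- The recursion is on the length `l`: the vertex attached next need not be the head of `R`.
  go : ∀ {L m} → Built G L m → ∀ R l → length R ≡ l → (∀ v → v ∈ L ⊎ v ∈ R) → md G ≤ m + l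
  go {L} {m} b [] zero refl cover =
    subst (md G ≤_) (sym (+-identityʳ m)) (built⇒md≤ b λ v → [ id , (λ ()) ]′ (cover v))
  go {L} {m} b (r ∷ R) (suc l) len cover with r ∈? L
  ... | yes r∈L = ≤-trans (go b R l (suc-injective len) λ v → drop v (cover v)) (+-monoʳ-≤ m (n≤1+n l))
    where
    drop : ∀ v → v ∈ L ⊎ v ∈ r ∷ R → v ∈ L ⊎ v ∈ R
    drop v (inj₁ v∈L)         = inj₁ v∈L
    drop v (inj₂ (here refl)) = inj₁ r∈L
    drop v (inj₂ (there v∈R)) = inj₂ v∈R
  ... | no r∉L with ∃∈ b
  ...   | u , u∈L with crossing G L u∈L r∉L (conn u r)
  ...     | x , y , x∈L , y∉L , e with extract ([ (λ y∈L → contradiction y∈L y∉L) , id ]′ (cover y))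
  ...       | R′ , len′ , rest = subst (md G ≤_) (sym (+-suc m l))
    (go (attach b x∈L e) R′ l (suc-injective (trans (sym len′) len)) λ v → move v (cover v))
    where
    move : ∀ v → v ∈ L ⊎ v ∈ r ∷ R → v ∈ y ∷ L ⊎ v ∈ R′
    move v (inj₁ v∈L) = inj₁ (there v∈L)
    move v (inj₂ v∈R) with v Fin.≟ y
    ... | yes refl = inj₁ (here refl)
    ... | no  v≢y  = inj₂ (rest v∈R v≢y)

-- A symmetric form of being complements, so that the two graphs may exchange roles.
Complementary : Graph n → Graph n → Set
Complementary A B = (∀ {u v} → u ≢ v → Adj A u v ⊎ Adj B u v) × (∀ {u v} → Adj A u v → ¬ Adj B u v)

complementary-sym : ∀ {A B : Graph n} → Complementary A B → Complementary B A
complementary-sym (total , excl) = (λ u≢v → swap (total u≢v)) , λ b a → excl a b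

-- Q and Q′ collect the vertices that are to be attached by a single edge in A
-- and B; each vertex of R ends up in at most one of them.
extendBoth : ∀ {A B : Graph n} {x y z L L′} → Complementary A B → Connected A → Connected B →
  Unique (x ∷ y ∷ z ∷ []) → All (_∈ L) (x ∷ y ∷ z ∷ []) → All (_∈ L′) (x ∷ y ∷ z ∷ []) →
  Built A L m → Built B L′ m′ → ∀ Q Q′ R →
  (∀ v → (v ∈ L ⊎ v ∈ Q) ⊎ v ∈ R) → (∀ v → (v ∈ L′ ⊎ v ∈ Q′) ⊎ v ∈ R) →
  md A + md B ≤ (m + length Q) + (m′ + length Q′) + length R
extendBoth {m = m} {m′} {A = A} {B} _ connA connB _ _ _ bA bB Q Q′ [] cover cover′ =
  subst (md A + md B ≤_) (sym (+-identityʳ _))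
    (+-mono-≤ (extend connA bA Q λ v → [ id , (λ ()) ]′ (cover v))
              (extend connB bB Q′ λ v → [ id , (λ ()) ]′ (cover′ v)))
extendBoth {n} {m} {m′} {A} {B} {x} {y} {z} {L} {L′} comp@(total , _) connA connB
  uniq@((x≢y ∷ x≢z ∷ []) ∷ (y≢z ∷ []) ∷ _) inL@(xL ∷ yL ∷ zL ∷ []) inL′@(xL′ ∷ yL′ ∷ zL′ ∷ [])
  bA bB Q Q′ (r ∷ R) cover cover′ = case
  where
  Goal : Set
  Goal = md A + md B ≤ (m + length Q) + (m′ + length Q′) + suc (length R)

  add : ∀ {v} {K P : List (Fin n)} → (v ∈ K ⊎ v ∈ P) ⊎ v ∈ r ∷ R → (v ∈ r ∷ K ⊎ v ∈ P) ⊎ v ∈ R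
  add (inj₁ (inj₁ v∈))   = inj₁ (inj₁ (there v∈))
  add (inj₁ (inj₂ v∈))   = inj₁ (inj₂ v∈)
  add (inj₂ (here refl)) = inj₁ (inj₁ (here refl))
  add (inj₂ (there v∈))  = inj₂ v∈

  defer : ∀ {v} {K P : List (Fin n)} → (v ∈ K ⊎ v ∈ P) ⊎ v ∈ r ∷ R → (v ∈ K ⊎ v ∈ r ∷ P) ⊎ v ∈ R
  defer (inj₁ (inj₁ v∈))   = inj₁ (inj₁ v∈)
  defer (inj₁ (inj₂ v∈))   = inj₁ (inj₂ (there v∈))
  defer (inj₂ (here refl)) = inj₁ (inj₂ (here refl))
  defer (inj₂ (there v∈))  = inj₂ v∈

  skip : ∀ {v} {K P : List (Fin n)} → r ∈ K → (v ∈ K ⊎ v ∈ P) ⊎ v ∈ r ∷ R → (v ∈ K ⊎ v ∈ P) ⊎ v ∈ R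
  skip r∈K (inj₁ v∈)          = inj₁ v∈
  skip r∈K (inj₂ (here refl)) = inj₁ (inj₁ r∈K)
  skip r∈K (inj₂ (there v∈))  = inj₂ v∈

  known : r ∈ L → r ∈ L′ → Goal
  known rL rL′ = ≤-trans
    (extendBoth comp connA connB uniq inL inL′ bA bB Q Q′ R (skip rL ∘ cover) (skip rL′ ∘ cover′))
    (+-monoʳ-≤ ((m + length Q) + (m′ + length Q′)) (n≤1+n (length R)))

  -- Free in `A`, while in `B` the vertex `r` moves from `R` to `Q′`: the total stays the same.
  byA : ∀ {a b} → a ∈ L → b ∈ L → a ≢ b → Adj A a r → Adj A b r → Goal
  byA aL bL a≢b e f = subst (md A + md B ≤_)
    (trans (cong (_+ length R) (trans (cong (m + length Q +_) (+-suc m′ _)) (+-suc (m + length Q) _)))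
      (sym (+-suc _ (length R))))
    (extendBoth comp connA connB uniq (All.map there inL) inL′ (attach² bA aL bL a≢b e f) bB
      Q (r ∷ Q′) R (add ∘ cover) (defer ∘ cover′))

  byB : ∀ {a b} → a ∈ L′ → b ∈ L′ → a ≢ b → Adj B a r → Adj B b r → Goal
  byB aL bL a≢b e f = subst (md A + md B ≤_)
    (trans (cong (λ s → s + (m′ + length Q′) + length R) (+-suc m (length Q)))
      (sym (+-suc _ (length R))))
    (extendBoth comp connA connB uniq inL (All.map there inL′) bA (attach² bB aL bL a≢b e f)
      (r ∷ Q) Q′ R (defer ∘ cover) (add ∘ cover′))

  case : Goal
  case with x Fin.≟ r | y Fin.≟ r | z Fin.≟ r
  ... | yes refl | _ | _ = known xL xL′
  ... | no _ | yes refl | _ = known yL yL′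
  ... | no _ | no _ | yes refl = known zL zL′
  -- Pigeonhole: two of the three edges from `r` lie in the same graph.
  ... | no x≢r | no y≢r | no z≢r with total x≢r | total y≢r | total z≢r
  ...   | inj₁ e | inj₁ f | _      = byA xL yL x≢y e f
  ...   | inj₁ e | inj₂ _ | inj₁ g = byA xL zL x≢z e g
  ...   | inj₁ _ | inj₂ f | inj₂ g = byB yL′ zL′ y≢z f g
  ...   | inj₂ _ | inj₁ f | inj₁ g = byA yL zL y≢z f g
  ...   | inj₂ e | inj₁ _ | inj₂ g = byB xL′ zL′ x≢z e g
  ...   | inj₂ e | inj₂ f | _      = byB xL′ yL′ x≢y e f

fresh : (xs : List (Fin n)) → length xs < n → ∃ (_∉ xs)
fresh xs lt with Fin.any? (λ v → ¬? (v ∈? xs))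
... | yes v∉ = v∉
... | no  ¬∃ = contradiction
  (cover⇒≤ xs λ v → decidable-stable (v ∈? xs) λ v∉ → ¬∃ (v , v∉)) (<⇒≱ lt)

pattern 1st = here refl
pattern 2nd = there 1st
pattern 3rd = there 2nd
pattern 4th = there 3rd
pattern 5th = there 4th
pattern 8th = there (there (there 5th))

-- The upper bound

-- The paw lies in `B`: the triangle `w y z` with `x` pendant at `w`, which leaves the path `y x z`
-- to `A`. The claw lies in `A` with center `x`, and its leaves form a triangle of `B`. The 5-cycle
-- `a b c d e` of `A` has the 5-cycle `a c e b d` of `B` as its complement.
data Config (A B : Graph n) : Set where
  paw  : ∀ {x y z w} → Adj A x y → Adj A x z →
         Adj B w x → Adj B w y → Adj B w z → Adj B y z → Config A B
  claw : ∀ {x y z w} → Adj A x y → Adj A x z → Adj A x w →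
         Adj B y z → Adj B y w → Adj B z w → Config A B
  pentagon : ∀ {a b c d e} → Adj A a b → Adj A b c → Adj A c d → Adj A d e → Adj A e a →
         Adj B a c → Adj B c e → Adj B e b → Adj B b d → Adj B d a → Config A B

∉-allFin : (xs : List (Fin n)) → Unique xs →
  Σ[ R ∈ List (Fin n) ] n ≡ length xs + length R × (∀ v → v ∈ xs ⊎ v ∈ R)
∉-allFin {n} xs u with extractAll u (λ {v} _ → ∈-allFin v)
... | R , len , split = R , trans (sym (length-tabulate {n = n} id)) len , λ v → split (∈-allFin v)

module _ {A B : Graph n} (comp : Complementary A B) (connA : Connected A) (connB : Connected B) where

  private
    relocate : ∀ {v : Fin n} {xs L Q R} → All (λ v → v ∈ L ⊎ v ∈ Q) xs → v ∈ xs ⊎ v ∈ R →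
               (v ∈ L ⊎ v ∈ Q) ⊎ v ∈ R
    relocate all = Sum.map₁ (All.lookup all)

    n+1≡ : ∀ {s} → n ≡ s → suc s ≤ n + 1
    n+1≡ refl = ≤-reflexive (+-comm 1 n)

  -- Each start costs one more than its number of vertices: 3 + 2 on the four vertices of a paw or
  -- claw, 3 + 3 on the five of a pentagon. Every vertex of `R` adds one.
  config⇒≤ : Config A B → md A + md B ≤ n + 1
  config⇒≤ (paw {x} {y} {z} {w} xy xz wx wy wz yz) =
    let (R , len , split) = ∉-allFin (x ∷ y ∷ z ∷ w ∷ [])
          ( (adj⇒≢ A xy ∷ adj⇒≢ A xz ∷ ≢-sym (adj⇒≢ B wx) ∷ [])
          ∷ (adj⇒≢ B yz ∷ ≢-sym (adj⇒≢ B wy) ∷ [])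
          ∷ (≢-sym (adj⇒≢ B wz) ∷ []) ∷ [] ∷ [])
    in ≤-trans
      (extendBoth comp connA connB
        ((adj⇒≢ A xy ∷ adj⇒≢ A xz ∷ []) ∷ (adj⇒≢ B yz ∷ []) ∷ [] ∷ [])
        (3rd ∷ 2nd ∷ 1st ∷ []) (1st ∷ 3rd ∷ 2nd ∷ [])
        (attach (attach (base x) 1st xy) 2nd xz)
        (attach (attach² (attach (base w) 1st wy) 2nd 1st (adj⇒≢ B wy) wz yz) 3rd wx)
        -- All edges from `w` to the path `y x z` are in `B`, so in `A` it is attached later.
        [ w ] [] R
        (relocate (inj₁ 3rd ∷ inj₁ 2nd ∷ inj₁ 1st ∷ inj₂ 1st ∷ []) ∘ split)
        (relocate (inj₁ 1st ∷ inj₁ 3rd ∷ inj₁ 2nd ∷ inj₁ 4th ∷ []) ∘ split))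
      (n+1≡ len)
  config⇒≤ (claw {x} {y} {z} {w} xy xz xw yz yw zw) =
    let (R , len , split) = ∉-allFin (x ∷ y ∷ z ∷ w ∷ [])
          ( (adj⇒≢ A xy ∷ adj⇒≢ A xz ∷ adj⇒≢ A xw ∷ [])
          ∷ (adj⇒≢ B yz ∷ adj⇒≢ B yw ∷ [])
          ∷ (adj⇒≢ B zw ∷ []) ∷ [] ∷ [])
    in ≤-trans
      (extendBoth comp connA connB
        ((adj⇒≢ B yz ∷ adj⇒≢ B yw ∷ []) ∷ (adj⇒≢ B zw ∷ []) ∷ [] ∷ [])
        (3rd ∷ 2nd ∷ 1st ∷ []) (3rd ∷ 2nd ∷ 1st ∷ [])
        (attach (attach (attach (base x) 1st xy) 2nd xz) 3rd xw)
        (attach² (attach (base y) 1st yz) 2nd 1st (adj⇒≢ B yz) yw zw)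
        -- In `B` the center `x` has no neighbor among the leaves and is attached later.
        [] [ x ] R
        (relocate (inj₁ 4th ∷ inj₁ 3rd ∷ inj₁ 2nd ∷ inj₁ 1st ∷ []) ∘ split)
        (relocate (inj₂ 1st ∷ inj₁ 3rd ∷ inj₁ 2nd ∷ inj₁ 1st ∷ []) ∘ split))
      (n+1≡ len)
  config⇒≤ (pentagon {a} {b} {c} {d} {e} ab bc cd de ea ac ce eb bd da) =
    let (R , len , split) = ∉-allFin (a ∷ b ∷ c ∷ d ∷ e ∷ [])
          ( (adj⇒≢ A ab ∷ adj⇒≢ B ac ∷ ≢-sym (adj⇒≢ B da) ∷ ≢-sym (adj⇒≢ A ea) ∷ [])
          ∷ (adj⇒≢ A bc ∷ adj⇒≢ B bd ∷ ≢-sym (adj⇒≢ B eb) ∷ [])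
          ∷ (adj⇒≢ A cd ∷ adj⇒≢ B ce ∷ [])
          ∷ (adj⇒≢ A de ∷ []) ∷ [] ∷ [])
    in ≤-trans
      (extendBoth comp connA connB
        ((adj⇒≢ A ab ∷ adj⇒≢ B ac ∷ []) ∷ (adj⇒≢ A bc ∷ []) ∷ [] ∷ [])
        (5th ∷ 4th ∷ 3rd ∷ []) (5th ∷ 2nd ∷ 4th ∷ [])
        (attach² (attach (attach (attach (base a) 1st ab) 1st bc) 1st cd) 1st 4th
          (adj⇒≢ B da) de (symm A ea))
        (attach² (attach (attach (attach (base a) 1st ac) 1st ce) 1st eb) 1st 4th
          (≢-sym (adj⇒≢ A ab)) bd (symm B da))
        [] [] R
        (relocate (inj₁ 5th ∷ inj₁ 4th ∷ inj₁ 3rd ∷ inj₁ 2nd ∷ inj₁ 1st ∷ []) ∘ split)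
        (relocate (inj₁ 5th ∷ inj₁ 2nd ∷ inj₁ 4th ∷ inj₁ 1st ∷ inj₁ 3rd ∷ []) ∘ split))
      (n+1≡ len)

-- Finding a configuration

module _ {A B : Graph n} (comp : Complementary A B) where

  private
    total : ∀ {u v} → u ≢ v → Adj A u v ⊎ Adj B u v
    total = proj₁ comp

    excl : ∀ {u v} → Adj A u v → ¬ Adj B u v
    excl = proj₂ comp

    a≢ = adj⇒≢ A
    b≢ = adj⇒≢ B
    a˘ = symm A
    b˘ = symm B

  -- Walk from `y` toward `z` until the next vertex is an `A`-neighbor of `z`; the current vertex is
  -- still a `B`-neighbor of `z`.
  inducedPath : ∀ {y z} → Joined A y z → Adj B y z →
    ∃[ x ] ∃[ y ] ∃[ z ] Adj A x y × Adj A x z × Adj B y z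
  inducedPath ε b = contradiction b (irrefl B)
  inducedPath {z = z} (_◅_ {j = p} e es) b with p Fin.≟ z
  ... | yes refl = contradiction b (excl e)
  ... | no  p≢z with total p≢z
  ...   | inj₁ pz = p , _ , z , a˘ e , pz , b
  ...   | inj₂ pz = inducedPath es pz

  -- An induced path on four vertices is self-complementary. A fifth vertex `u` closes a pentagon if
  -- its `A`-neighbors on the path are exactly the ends; otherwise `u` and three path vertices form
  -- a paw or a claw in one of the graphs.
  pathConfig : ∀ {a b c d u} → Adj A a b → Adj A b c → Adj A c d →
    Adj B a c → Adj B b d → Adj B a d → u ∉ a ∷ b ∷ c ∷ d ∷ [] → Config A B ⊎ Config B A
  pathConfig {a} {b} {c} {d} {u} ab bc cd ac bd ad u∉
    with total {u} {a} (λ { refl → u∉ 1st }) | total {u} {b} (λ { refl → u∉ 2nd })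
       | total {u} {c} (λ { refl → u∉ 3rd }) | total {u} {d} (λ { refl → u∉ 4th })
  ... | inj₂ ua | inj₁ ub | inj₁ uc | _       = inj₂ (paw ac (b˘ ua) (a˘ ab) bc (a˘ ub) (a˘ uc))
  ... | inj₁ ua | inj₁ ub | inj₁ uc | inj₂ ud = inj₂ (paw (b˘ bd) (b˘ ud) cd (a˘ bc) (a˘ uc) (a˘ ub))
  ... | inj₁ ua | inj₁ ub | inj₁ uc | inj₁ ud = inj₂ (paw (b˘ ad) (b˘ bd) ud ua ub ab)
  ... | inj₂ ua | inj₂ ub | inj₂ uc | _       = inj₁ (paw (a˘ ab) bc ub ua uc ac)
  ... | inj₁ ua | inj₂ ub | inj₂ uc | inj₂ ud = inj₁ (paw (a˘ bc) cd uc ub ud bd)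
  ... | inj₁ ua | inj₂ ub | inj₂ uc | inj₁ ud =
    inj₁ (pentagon ab bc cd (a˘ ud) ua ac (b˘ uc) ub bd (b˘ ad))
  ... | inj₂ ua | inj₁ ub | inj₂ uc | _       = inj₁ (claw (a˘ ab) bc (a˘ ub) ac (b˘ ua) (b˘ uc))
  ... | inj₁ ua | inj₁ ub | inj₂ uc | _       = inj₂ (paw (b˘ ac) (b˘ uc) bc (a˘ ab) (a˘ ub) (a˘ ua))
  ... | _       | inj₂ ub | inj₁ uc | inj₂ ud = inj₁ (claw (a˘ bc) cd (a˘ uc) bd (b˘ ub) (b˘ ud))
  ... | _       | inj₂ ub | inj₁ uc | inj₁ ud = inj₂ (paw bd (b˘ ub) (a˘ bc) cd (a˘ uc) (a˘ ud))

  -- The 4-cycle is x y w z.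
  squareConfig : ∀ {x y z w u} → Adj A x y → Adj A x z → Adj A w y → Adj A w z →
    Adj B x w → Adj B y z → Adj B y u → u ≢ z → Config A B ⊎ Config B A
  squareConfig {x} {y} {z} {w} {u} xy xz wy wz xw yz yu u≢z
    -- If `x` or `w` is an `A`-neighbor of `u`, it forms a paw or a claw with `y`, `z`, `u`.
    -- Otherwise `u x w` is a triangle of `B` with `y` pendant at `u`.
    with total {u} {x} (λ { refl → excl xy (b˘ yu) }) | total {u} {w} (λ { refl → excl wy (b˘ yu) })
       | total u≢z
  ... | inj₁ ux | _       | inj₁ uz = inj₂ (paw yz yu xy xz (a˘ ux) (a˘ uz))
  ... | inj₁ ux | _       | inj₂ uz = inj₁ (claw xy xz (a˘ ux) yz yu (b˘ uz))
  ... | inj₂ _  | inj₁ uw | inj₁ uz = inj₂ (paw yz yu wy wz (a˘ uw) (a˘ uz))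
  ... | inj₂ _  | inj₁ uw | inj₂ uz = inj₁ (claw wy wz (a˘ uw) yz yu (b˘ uz))
  ... | inj₂ ux | inj₂ uw | _       = inj₁ (paw (a˘ xy) (a˘ wy) (b˘ yu) ux uw xw)

  -- Start from an induced path `y x z` of `A` and a `B`-neighbor `w` of `x`. The edges from `w` to
  -- `y` and `z` give a paw, an induced path on four vertices, or a 4-cycle of `A`.
  config : n ≥ 5 → Connected A → Connected B → Config A B ⊎ Config B A
  config n≥5 connA connB
    with (s , _) ← fresh [] (≤-trans (s≤s z≤n) n≥5)
    with (t , t∉) ← fresh [ s ] (≤-trans (s≤s (s≤s z≤n)) n≥5)
    with (_ , b₀) ← firstEdge B (λ { refl → t∉ 1st }) (connB s t)
    with (x , y , z , xy , xz , yz) ← inducedPath (connA _ _) b₀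
    with (w , xw) ← firstEdge B (a≢ xy) (connB x y)
    with total {w} {y} (λ { refl → excl xy xw }) | total {w} {z} (λ { refl → excl xz xw })
  ... | inj₂ wy | inj₂ wz = inj₁ (paw xy xz (b˘ xw) wy wz yz)
  ... | inj₁ wy | inj₂ wz = pathConfig wy (a˘ xy) xz (b˘ xw) yz wz (proj₂ (fresh _ n≥5))
  ... | inj₂ wy | inj₁ wz = pathConfig wz (a˘ xz) xy (b˘ xw) (b˘ yz) wy (proj₂ (fresh _ n≥5))
  -- On these four vertices `B` has only the edges `xw` and `yz`, so an edge of `B` leaving `y`, `z`
  -- ends outside the 4-cycle.
  ... | inj₁ wy | inj₁ wz with crossing B (y ∷ z ∷ []) 1st
                                 (λ { 1st → a≢ xy refl ; 2nd → a≢ xz refl }) (connB y x)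
  ...   | y , u , 1st , u∉ , yu = squareConfig xy xz wy wz xw yz yu (λ { refl → u∉ 2nd })
  ...   | z , u , 2nd , u∉ , zu = squareConfig xz xy wz wy xw (b˘ yz) zu (λ { refl → u∉ 1st })

upperBound : (G : Graph n) → Connected G → Connected (complement G) → n ≥ 5 →
             md G + md (complement G) ≤ n + 1
upperBound {n} G conn connᶜ n≥5 = [ config⇒≤ comp conn connᶜ
  , subst (_≤ n + 1) (+-comm (md (complement G)) (md G)) ∘
      config⇒≤ (complementary-sym {A = G} {complement G} comp) connᶜ conn
  ]′ (config comp n≥5 conn connᶜ)
  where
  total : ∀ {u v} → u ≢ v → Adj G u v ⊎ Adj (complement G) u v
  total {u} {v} u≢v with adj? G u v
  ... | yes e = inj₁ e
  ... | no ¬e = inj₂ (u≢v , ¬e)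

  comp : Complementary G (complement G)
  comp = total , λ e (_ , ¬e) → ¬e e

-- Sharpness of the upper bound

module _ {G : Graph n} (c : Coloring G k) where

  -- Such a `P` is a union of components once color `i` is removed.
  colorCut : ∀ {u v} i (P : Pred (Fin n) 0ℓ) →
    (∀ {x y} (e : Adj G x y) → at c e ≢ i → P x → P y) → P u → ¬ P v →
    Σ[ M ∈ EdgeSet G ] MonochromaticCut c u v M
  colorCut i P closed pu ¬pv =
    colorClass c i , (λ e f p q → trans (∈-colorClass⁻ p) (sym (∈-colorClass⁻ q))) , λ p → ¬pv (go p pu)
    where
    go : ∀ {x y} → Joined (removeEdges G (colorClass c i)) x y → P x → P y
    go ε              px = px
    go ((e , e∉) ◅ p) px = go p (closed e (λ eq → contradiction (trans (sym (∈-colorClass⁺ eq)) e∉) λ ()) px)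

  cut-sym : ∀ {u v} → Σ[ M ∈ EdgeSet G ] MonochromaticCut c u v M →
            Σ[ M ∈ EdgeSet G ] MonochromaticCut c v u M
  cut-sym (M , mono , ¬p) = M , mono , ¬p ∘ reverse (symm (removeEdges G M))

-- The tree in which the parent of vertex suc i is parent i.
module Tree (parent : Fin n → Fin (suc n)) (parent≤ : ∀ i → toℕ (parent i) ≤ toℕ i) where

  Child : Rel (Fin (suc n)) 0ℓ
  Child zero    v = ⊥
  Child (suc i) v = parent i ≡ v

  child? : Decidable Child
  child? zero    v = no λ ()
  child? (suc i) v = parent i Fin.≟ v

  child⇒> : ∀ {u v} → Child u v → toℕ v < toℕ u
  child⇒> {suc i} refl = s≤s (parent≤ i)

  tree : Graph (suc n)
  tree .Adj u v         = Child u v ⊎ Child v u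
  tree .adj? u v        = child? u v ⊎-dec child? v u
  tree .symm            = swap
  tree .irrefl (inj₁ p) = <-irrefl refl (child⇒> p)
  tree .irrefl (inj₂ p) = <-irrefl refl (child⇒> p)

  tree-connected : Connected tree
  tree-connected u v = toRoot u _ ≤-refl ◅◅ reverse swap (toRoot v _ ≤-refl)
    where
    -- The bound `m` carries the recursion, as a parent is not a structural part of its child.
    toRoot : ∀ u m → toℕ u ≤ m → Joined tree u zero
    toRoot zero    m       _         = ε
    toRoot (suc i) (suc m) (s≤s i≤m) = inj₁ refl ◅ toRoot (parent i) m (≤-trans (parent≤ i) i≤m)

  rainbow : Coloring tree n
  rainbow .at = [ edgeBelow , edgeBelow ]′
    where
    edgeBelow : ∀ {u v} → Child u v → Fin n
    edgeBelow {suc i} _ = i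
  rainbow .unordered {suc i}     (inj₁ _) (inj₂ _) = refl
  rainbow .unordered {_} {suc j} (inj₂ _) (inj₁ _) = refl
  rainbow .unordered {u} {v}     (inj₁ p) (inj₁ q) = contradiction (child⇒> {u} p) (<-asym (child⇒> {v} q))
  rainbow .unordered {u} {v}     (inj₂ p) (inj₂ q) = contradiction (child⇒> {v} p) (<-asym (child⇒> {u} q))

  data Descendant (u : Fin (suc n)) : Pred (Fin (suc n)) 0ℓ where
    self  : Descendant u u
    child : ∀ {v w} → Child w v → Descendant u v → Descendant u w

  descendant⇒≥ : ∀ {u w} → Descendant u w → toℕ u ≤ toℕ w
  descendant⇒≥ self        = ≤-refl
  descendant⇒≥ (child p d) = ≤-trans (descendant⇒≥ d) (<⇒≤ (child⇒> p))

  -- Only the edge from `suc i` to its parent leaves the subtree below `suc i`, and it has color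
  -- `i`.
  descendant-closed : ∀ {i x y} (e : Adj tree x y) → at rainbow e ≢ i →
                      Descendant (suc i) x → Descendant (suc i) y
  descendant-closed (inj₂ p)            _   d                    = child p d
  descendant-closed {x = suc i} (inj₁ refl) e≢i self             = contradiction refl e≢i
  descendant-closed {x = suc i} (inj₁ refl) e≢i (child refl d)   = d

  -- Descendants of `u` have numbers at least that of `u`, so `v` is outside its subtree.
  parentCut : ∀ {u v} → toℕ v < toℕ u → Σ[ M ∈ EdgeSet tree ] MonochromaticCut rainbow u v M
  parentCut {suc i} v<u = colorCut rainbow i (Descendant (suc i)) descendant-closed self
    λ d → <⇒≱ v<u (descendant⇒≥ d)

  rainbow-md : IsMDColoring rainbow
  rainbow-md u v u≢v with <-cmp (toℕ u) (toℕ v)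
  ... | tri< u<v _ _ = cut-sym rainbow (parentCut u<v)
  ... | tri≈ _ u≡v _ = contradiction (Fin.toℕ-injective u≡v) u≢v
  ... | tri> _ _ v<u = parentCut v<u

  n≤md-tree : n ≤ md tree
  n≤md-tree = onto⇒≤md rainbow (rainbow-md , λ i → suc i , parent i , inj₁ refl , refl)

module _ (G : Graph (suc n)) {p : Fin (suc n)} (pendant : ∀ {v} → Adj G zero v → v ≡ p) where

  pendantColoring : Coloring G 2
  pendantColoring .at {u} {v} _ = color u v
    where
    color : Fin (suc n) → Fin (suc n) → Fin 2
    color (suc _) (suc _) = suc zero
    color _       _       = zero
  pendantColoring .unordered {zero}  {zero}  _ _ = refl
  pendantColoring .unordered {zero}  {suc _} _ _ = refl
  pendantColoring .unordered {suc _} {zero}  _ _ = refl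
  pendantColoring .unordered {suc _} {suc _} _ _ = refl

  -- Removing the pendant edge isolates `zero`. Removing all other edges leaves at most the
  -- component of `zero` and `p` nontrivial, which separates any two vertices other than `zero`.
  pendantColoring-md : IsMDColoring pendantColoring
  pendantColoring-md zero    zero    u≢v = contradiction refl u≢v
  pendantColoring-md zero    (suc v) u≢v =
    colorCut pendantColoring zero (_≡ zero) (λ { _ e≢0 refl → contradiction refl e≢0 }) refl λ ()
  pendantColoring-md (suc u) zero    u≢v = cut-sym pendantColoring (pendantColoring-md zero (suc u) λ ())
  pendantColoring-md (suc u) (suc v) u≢v =
    colorCut pendantColoring (suc zero) (λ w → w ≡ suc u ⊎ w ≡ zero × suc u ≡ p) closed (inj₁ refl)
      λ { (inj₁ refl) → u≢v refl }
    where
    closed : ∀ {x y} (e : Adj G x y) → at pendantColoring e ≢ suc zero →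
             x ≡ suc u ⊎ x ≡ zero × suc u ≡ p → y ≡ suc u ⊎ y ≡ zero × suc u ≡ p
    closed {y = zero}  e _   (inj₁ refl)       = inj₂ (refl , pendant (symm G e))
    closed {y = suc y} e e≢1 (inj₁ refl)       = contradiction refl e≢1
    closed             e _   (inj₂ (refl , u≡p)) = inj₁ (trans (pendant e) (sym u≡p))

  pendant⇒2≤md : ∀ {u v} → Adj G zero p → Adj G (suc u) (suc v) → 2 ≤ md G
  pendant⇒2≤md e f = onto⇒≤md pendantColoring (pendantColoring-md , λ where
    zero       → _ , _ , e , refl
    (suc zero) → _ , _ , f , refl)

-- A star with one edge subdivided; 0 is the center and 1 the subdividing vertex.
module Broom (m : ℕ) where

  parent : Fin (4 + m) → Fin (5 + m)
  parent (suc zero) = suc zero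
  parent _          = zero

  parent≤ : ∀ i → toℕ (parent i) ≤ toℕ i
  parent≤ zero          = z≤n
  parent≤ (suc zero)    = s≤s z≤n
  parent≤ (suc (suc i)) = z≤n

  open Tree parent parent≤ public

  0—2 : Adj (complement tree) zero 2F
  0—2 = (λ ()) , λ { (inj₁ ()) ; (inj₂ ()) }

  2—3 : Adj (complement tree) 2F 3F
  2—3 = (λ ()) , λ { (inj₁ ()) ; (inj₂ ()) }

  -- Vertex 3 is a leaf at the center, so in the complement it misses only the center, which is
  -- reached through 2.
  complement-connected : Connected (complement tree)
  complement-connected u v = to3 u ◅◅ reverse (symm (complement tree)) (to3 v)
    where
    to3 : ∀ u → Joined (complement tree) u 3F
    to3 zero          = 0—2 ◅ 2—3 ◅ ε
    to3 (suc zero)    = ((λ ()) , λ { (inj₁ ()) ; (inj₂ ()) }) ◅ ε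
    to3 2F            = 2—3 ◅ ε
    to3 3F            = ε
    to3 (suc (suc (suc (suc u)))) = ((λ ()) , λ { (inj₁ ()) ; (inj₂ ()) }) ◅ ε

  -- The center misses only vertex 2 in the tree, so it is pendant in the complement.
  2≤md-complement : 2 ≤ md (complement tree)
  2≤md-complement = pendant⇒2≤md (complement tree) pendant 0—2 2—3
    where
    pendant : ∀ {v} → Adj (complement tree) zero v → v ≡ 2F
    pendant {zero}              (0≢0 , _) = contradiction refl 0≢0
    pendant {suc zero}          (_ , ¬e)  = contradiction (inj₂ refl) ¬e
    pendant {2F}                _         = refl
    pendant {suc (suc (suc v))} (_ , ¬e)  = contradiction (inj₂ refl) ¬e

upperBound-sharp : n ≥ 5 → Σ[ G ∈ Graph n ] Connected G × Connected (complement G) ×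
                   md G + md (complement G) ≡ n + 1
upperBound-sharp n≥5@(s≤s (s≤s (s≤s (s≤s (s≤s (z≤n {m})))))) =
  tree , tree-connected , complement-connected ,
  ≤-antisym (upperBound tree tree-connected complement-connected n≥5)
    -- With `n = 5 + m`, the tree contributes `n - 1` and its complement 2.
    (≤-trans (≤-reflexive (cong (4 +_) (trans (cong suc (+-comm m 1)) (+-comm 2 m))))
      (+-mono-≤ n≤md-tree 2≤md-complement))
  where open Broom m

-- Sharpness of the lower bound

-- This attaches arbitrarily many replicas at no cost, through two common neighbors.
attachAll : ∀ {G : Graph n} {L a b} → Built G L m → a ∈ L → b ∈ L → a ≢ b →
            ∀ {R} → All (λ v → Adj G a v × Adj G b v) R → Built G (R ++ L) m
attachAll bL a∈L b∈L a≢b []             = bL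
attachAll bL a∈L b∈L a≢b {_ ∷ R} ((e , f) ∷ es) =
  attach² (attachAll bL a∈L b∈L a≢b es) (∈-++⁺ʳ R a∈L) (∈-++⁺ʳ R b∈L) a≢b e f

-- The square of the path 0, …, 7, in which vertex 7 is replicated: all
-- vertices from 7 on are independent and have the neighbors 5 and 6.
module PathSquare (m : ℕ) where

  near : ℕ → Bool
  near 1 = true
  near 2 = true
  near _ = false

  position : Fin (8 + m) → ℕ
  position u = toℕ u ⊓ 7

  graph : Graph (8 + m)
  graph .Adj u v  = T (near ∣ position u - position v ∣)
  graph .adj? u v = T? (near ∣ position u - position v ∣)
  graph .symm {u} {v} = subst (T ∘ near) (∣-∣-comm (position u) (position v))
  graph .irrefl {u} = subst (T ∘ near) (∣n-n∣≡0 (position u))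

  ⟨_⟩ : Fin 8 → Fin (8 + m)
  ⟨ i ⟩ = i Fin.↑ˡ m

  beyond : List (Fin (8 + m))
  beyond = tabulate (8 Fin.↑ʳ_)

  cover : ∀ L → All (λ i → ⟨ i ⟩ ∈ L) (allFin 8) → ∀ v → v ∈ beyond ++ L
  cover L all v with Fin.splitAt 8 v | Fin.join-splitAt 8 m v
  ... | inj₁ i | refl = ∈-++⁺ʳ beyond (All.lookup all (∈-allFin i))
  ... | inj₂ j | refl = ∈-++⁺ˡ (∈-tabulate⁺ j)

  -- Read from the right: from the third vertex on, each has two earlier neighbors, in the graph for
  -- `order` and in the complement for `orderᶜ`.
  order orderᶜ : List (Fin (8 + m))
  order  = ⟨ 7F ⟩ ∷ ⟨ 6F ⟩ ∷ ⟨ 5F ⟩ ∷ ⟨ 4F ⟩ ∷ ⟨ 3F ⟩ ∷ ⟨ 2F ⟩ ∷ ⟨ 1F ⟩ ∷ ⟨ 0F ⟩ ∷ []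
  orderᶜ = ⟨ 5F ⟩ ∷ ⟨ 2F ⟩ ∷ ⟨ 1F ⟩ ∷ ⟨ 4F ⟩ ∷ ⟨ 7F ⟩ ∷ ⟨ 6F ⟩ ∷ ⟨ 3F ⟩ ∷ ⟨ 0F ⟩ ∷ []

  built : Built graph (beyond ++ order) 1
  built = attachAll
    (attach² (attach² (attach² (attach² (attach² (attach² (attach (base _)
      1st _) 1st 2nd (λ ()) _ _) 1st 2nd (λ ()) _ _) 1st 2nd (λ ()) _ _)
      1st 2nd (λ ()) _ _) 1st 2nd (λ ()) _ _) 1st 2nd (λ ()) _ _)
    -- The common neighbors of the replicas are 6 and 5.
    2nd 3rd (λ ()) (All.tabulate⁺ λ _ → _)

  builtᶜ : Built (complement graph) (beyond ++ orderᶜ) 1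
  builtᶜ = attachAll
    (attach² (attach² (attach² (attach² (attach² (attach² (attach (base _)
      1st far) 1st 2nd (λ ()) far far) 2nd 3rd (λ ()) far far) 1st 4th (λ ()) far far)
      1st 2nd (λ ()) far far) 3rd 4th (λ ()) far far) 1st 2nd (λ ()) far far)
    -- In the complement all replicas are adjacent to 0 and 1.
    8th 3rd (λ ()) (All.tabulate⁺ λ _ → far , far)
    where
    far : ∀ {u v} {nonadj : True (adj? (complement graph) u v)} → Adj (complement graph) u v
    far {nonadj = nonadj} = toWitness nonadj

  cover-order : ∀ v → v ∈ beyond ++ order
  cover-order = cover order (toWitness {a? = All.all? (λ i → ⟨ i ⟩ ∈? order) (allFin 8)} _)

  cover-orderᶜ : ∀ v → v ∈ beyond ++ orderᶜ
  cover-orderᶜ = cover orderᶜ (toWitness {a? = All.all? (λ i → ⟨ i ⟩ ∈? orderᶜ) (allFin 8)} _)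

lowerBound-sharp : n ≥ 8 → Σ[ G ∈ Graph n ] Connected G × Connected (complement G) ×
                   md G + md (complement G) ≡ 2
lowerBound-sharp (s≤s (s≤s (s≤s (s≤s (s≤s (s≤s (s≤s (s≤s (z≤n {m}))))))))) =
  graph , conn , connᶜ ,
  cong₂ _+_ (≤-antisym (built⇒md≤ built cover-order) (connected⇒1≤md graph conn))
            (≤-antisym (built⇒md≤ builtᶜ cover-orderᶜ) (connected⇒1≤md (complement graph) connᶜ))
  where
  open PathSquare m

  conn : Connected graph
  conn = built⇒connected built cover-order

  connᶜ : Connected (complement graph)
  connᶜ = built⇒connected builtᶜ cover-orderᶜ

theorem4p3 : ∀ (n : ℕ) →
    (∀ (G : Graph n) → Connected G → Connected (complement G) →
    (n ≥ 5 → md G + md (complement G) ≤ n + 1) ×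
    (n ≥ 8 → md G + md (complement G) ≥ 2)) ×
    (n ≥ 5 → Σ[ G ∈ Graph n ] Connected G × Connected (complement G) ×
    md G + md (complement G) ≡ n + 1) ×
    (n ≥ 8 → Σ[ G ∈ Graph n ] Connected G × Connected (complement G) ×
    md G + md (complement G) ≡ 2)
theorem4p3 n =
  (λ G conn connᶜ → upperBound G conn connᶜ , λ { (s≤s (s≤s _)) →
    +-mono-≤ (connected⇒1≤md G conn) (connected⇒1≤md (complement G) connᶜ) }) ,
  upperBound-sharp , lowerBound-sharp
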